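{- Let $n\ge1$ and let $(f_{ij})_{0\le j\le i\le n-1}$ be the $f$-triangle of $\Delta_{\mathrm{Dyck}_n}$. (i) For $0\le j\le n-1$, the column sum $f_{j-1}=\sum_{i\ge0}f_{ij}$ is the Narayana number $N_{n,j+1}$. In particular, the $f$-vector $(f_{ -1},\ldots,f_{n-2})$ of $\Delta_{\mathrm{Dyck}_n}$ is $(N_{n,1},\ldots,N_{n,n})$. (ii) For $0\le i\le n-1$, the sum of the entries in the $i$th row satisfies \[ \sum_{j=0}^{i}f_{ij}=\Big|\bigl\{\,w\in\mathrm{Dyck}_n : \mu(w)=i\,\bigr\}\Big| . \]
   Context: The Narayana numbers are $N_{n,k}=\frac1n\binom nk\binom n{k-1}$, $1\le k\le n$. A Dyck path of semilength $n$ is a word $w=w_1\cdots w_{2n}$ in $\{U,D\}$ with equally many $U$'s and $D$'s such that every prefix contains at least as many $U$'s as $D$'s; $\mathrm{Dyck}_n$ is the set of these. A valley of $w$ is an index $i$ with $w_i=D$, $w_{i+1}=U$, identified with its position $(i,y)$, where $y$ is the number of $U$'s minus the number of $D$'s in $w_1\cdots w_i$. $V(w)$ is the set of valley positions of $w$, and $\Delta_{\mathrm{Dyck}_n}=\{V(w):w\in\mathrm{Dyck}_n\}$, which is a simplicial complex of dimension $n-2$. For $w\in\mathrm{Dyck}_n$ with valleys $p_1,\ldots,p_\ell$ listed from left to right, let $p_0=(0,0)$ be the starting point and $p_{\ell+1}=(2n,0)$ the terminal point of $w$. For $1\le i\le\ell+1$ let $u_i$ and $d_i$ be the numbers of $U$-steps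 and $D$-steps in the portion of $w$ from $p_{i-1}$ to $p_i$. Define $\mu(w)=\Bigl(\sum_{i=1}^{\ell+1}\min\{u_i,d_i\}\Bigr)-1$. For a simplicial complex $\Delta$, $f_k$ is the number of faces of dimension $k$ (cardinality $k+1$). The degree of a face $\sigma$ is $\deg(\sigma)=\max\{|\tau| : \tau\in\Delta,\ \sigma\subseteq\tau\}$. The $f$-triangle of $\Delta$ is the array $(f_{ij})$ where $f_{ij}$ is the number of faces $\sigma$ with $|\sigma|=j$ and $\deg(\sigma)=i$. -}

module Defs where

open import Data.Nat using (ℕ; zero; suc; _+_; _*_; _∸_; _⊓_; _≤_; NonZero)
import Data.Nat.Properties as ℕₚ
open import Data.Nat.ListAction using (sum)
open import Data.Nat.Combinatorics using (_C_)
open import Data.Integer using (ℤ; +_; 0ℤ; _⊖_)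
import Data.Integer.Properties as ℤₚ
open import Data.Rational using (ℚ; _/_)
open import Data.List
  using (List; []; _∷_; [_]; _++_; map; filter; deduplicate; length; take; drop;
         inits; upTo; applyUpTo)
open import Data.List.Extrema.Nat using (max)
open import Data.List.Relation.Unary.All using (All; all?)
import Data.List.Relation.Binary.Subset.DecPropositional as DecSubset
open import Data.Maybe using (Maybe; just; nothing)
import Data.Maybe.Properties as Maybeₚ
open import Data.Product using (_×_; _,_; proj₁)
import Data.Product.Properties as ×ₚ
open import Relation.Binary.Definitions using (Decidable; DecidableEquality)
open import Relation.Binary.PropositionalEquality using (_≡_; refl)
open import Relation.Nullary.Decidable using (yes; no; _×-dec_)
open import Relation.Unary using () renaming (Decidable to Decidable₁)

∑< : ℕ → (ℕ → ℕ) → ℕ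
∑< m f = sum (applyUpTo f m)

syntax ∑< m (λ i → e) = ∑[ i < m ] e

toℚ : ℕ → ℚ
toℚ k = + k / 1

-- Meant for 1 ≤ k ≤ n.  The division is exact rational division.
narayana : (n : ℕ) → .{{_ : NonZero n}} → ℕ → ℚ
narayana n k = + ((n C k) * (n C (k ∸ 1))) / n

------------------------------------------------------------------------
-- Dyck paths

data Step : Set where
  U D : Step

_≟ₛ_ : DecidableEquality Step
U ≟ₛ U = yes refl
U ≟ₛ D = no λ ()
D ≟ₛ U = no λ ()
D ≟ₛ D = yes refl

Word : Set
Word = List Step

#U #D : Word → ℕ
#U w = length (filter (U ≟ₛ_) w)
#D w = length (filter (D ≟ₛ_) w)

words : ℕ → List Word
words zero    = [ [] ]
words (suc m) = map (U ∷_) (words m) ++ map (D ∷_) (words m)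

IsDyck : Word → Set
IsDyck w = #U w ≡ #D w × All (λ p → #D p ≤ #U p) (inits w)

isDyck? : Decidable₁ IsDyck
isDyck? w = (#U w ℕₚ.≟ #D w) ×-dec all? (λ p → #D p ℕₚ.≤? #U p) (inits w)

Dyck : ℕ → List Word
Dyck n = filter isDyck? (words (2 * n))

-- Letters are numbered from 1.
_‼_ : Word → ℕ → Maybe Step
[]      ‼ i           = nothing
(s ∷ w) ‼ zero        = nothing
(s ∷ w) ‼ suc zero    = just s
(s ∷ w) ‼ suc (suc i) = w ‼ suc i

IsValley : Word → ℕ → Set
IsValley w i = (w ‼ i ≡ just D) × (w ‼ suc i ≡ just U)

isValley? : (w : Word) → Decidable₁ (IsValley w)
isValley? w i = Maybeₚ.≡-dec _≟ₛ_ (w ‼ i) (just D)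
          ×-dec Maybeₚ.≡-dec _≟ₛ_ (w ‼ suc i) (just U)

Position : Set
Position = ℕ × ℤ

_≟ₚ_ : DecidableEquality Position
_≟ₚ_ = ×ₚ.≡-dec ℕₚ._≟_ ℤₚ._≟_

height : Word → ℕ → ℤ
height w i = #U (take i w) ⊖ #D (take i w)

-- The valleys from left to right, hence without repetition.
V : Word → List Position
V w = map (λ i → i , height w i) (filter (isValley? w) (upTo (length w)))

-- The part of w between abscissas a ≤ b.
portion : Word → ℕ → ℕ → Word
portion w a b = take (b ∸ a) (drop a w)

-- ∑ min{uᵢ , dᵢ} over the portions between consecutive listed points.
sumMin : Word → List Position → ℕ
sumMin w (p ∷ q ∷ ps) = #U s ⊓ #D s + sumMin w (q ∷ ps)
  where s = portion w (proj₁ p) (proj₁ q)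
sumMin w _            = 0

μ : Word → ℤ
μ w = sumMin w ((0 , 0ℤ) ∷ V w ++ [ (length w , 0ℤ) ]) ⊖ 1

------------------------------------------------------------------------
-- Finite simplicial complexes on positions.  A face is a finite set, given
-- as a repetition-free list, so that its cardinality is its length; a
-- complex is the list of its faces, each occurring once up to set equality.

open DecSubset _≟ₚ_ using (_⊆_; _⊆?_)

Face : Set
Face = List Position

Complex : Set
Complex = List Face

_≐_ : Face → Face → Set
σ ≐ τ = σ ⊆ τ × τ ⊆ σ

_≐?_ : Decidable _≐_
σ ≐? τ = (σ ⊆? τ) ×-dec (τ ⊆? σ)

ΔDyck : ℕ → Complex
ΔDyck n = deduplicate _≐?_ (map V (Dyck n))

dim : Face → ℤ
dim σ = length σ ⊖ 1

fNumber : Complex → ℤ → ℕ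
fNumber Δ k = length (filter (λ σ → dim σ ℤₚ.≟ k) Δ)

-- (f₋₁ , … , f_d), where d + 1 is the largest cardinality of a face.
fVector : Complex → List ℕ
fVector Δ = map (λ j → fNumber Δ (j ⊖ 1)) (upTo (suc (max 0 (map length Δ))))

-- For σ ∈ Δ the maximum is over a nonempty list, so the default 0 is harmless.
deg : Complex → Face → ℕ
deg Δ σ = max 0 (map length (filter (σ ⊆?_) Δ))

fTriangle : Complex → ℕ → ℕ → ℕ
fTriangle Δ i j =
  length (filter (λ σ → (length σ ℕₚ.≟ j) ×-dec (deg Δ σ ℕₚ.≟ i)) Δ)

{-# OPTIONS --safe #-}

-- A Dyck path is determined by its valley set: where two paths with the same
-- end points first differ, the one that descends has a later valley with the
-- same number of U's, which the other cannot have.  So the faces correspond to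
-- the Dyck paths.
--
-- (i) Splitting off the first letter gives a recurrence for the number of
-- nonnegative paths from height h to 0 with a U's, b = h + a D's and k valleys.
-- By Pascal's rule it is solved by the reflection-type formula
-- C(a,k) C(b,k) - C(a+1,k+1) C(b-1,k-1), which for a = b = n is N_{n,k+1}.
--
-- (ii) The degree of V(w) is μ(w).  If V(w) ⊆ V(v), then v passes through the
-- valleys of w, and each of its portions between them starts with U, ends in D
-- and has uᵢ U's and dᵢ D's, hence at most min{uᵢ , dᵢ} - 1 inner valleys.  The
-- bound is attained by replacing every portion by a zigzag.

module Submission where

open import Defs
open import Data.Nat using (ℕ; zero; suc; _+_; _*_; _⊓_; _≤_; _<_; z≤n; s≤s; NonZero; ≢-nonZero⁻¹)
open import Data.Nat.Properties hiding (_≟_)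
import Data.Nat.Properties as ℕₚ
open import Data.Nat.Combinatorics using (_C_; nC1≡n; k>n⇒nCk≡0; nCk+nC[k+1]≡[n+1]C[k+1])
open import Data.Nat.ListAction using (sum)
open import Data.Nat.ListAction.Properties using (sum-++)
open import Data.Nat.Tactic.RingSolver using (solve-∀)
open import Data.Integer using (+_; 0ℤ; _⊖_; _≟_)
import Data.Integer as ℤ
import Data.Integer.Properties as ℤₚ
open import Data.Rational using (_/_)
open import Data.Rational.Properties using (fromℚᵘ-cong)
open import Data.Rational.Unnormalised using (mkℚᵘ; *≡*)
open import Data.Bool using (Bool; true; false; T)
open import Data.Bool.Properties using (T?)
open import Data.Empty using (⊥-elim)
open import Data.List
  using (List; []; _∷_; [_]; _++_; _∷ʳ_; map; filter; deduplicate; length; replicate;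
         take; drop; inits; upTo; applyUpTo)
open import Data.List.Properties
  using (length-++; length-map; ++-assoc; ++-identityʳ; ∷-injectiveʳ; map-∘; map-cong;
         applyUpTo-∷ʳ; filter-++; filter-accept; filter-reject; filter-all; filter-none)
open import Data.List.Extrema.Nat using (max; max<v⁺; xs≤max)
open import Data.List.Membership.Propositional using (_∈_)
open import Data.List.Membership.Propositional.Properties
  using (∈-filter⁺; ∈-filter⁻; ∈-map⁺; ∈-map⁻; ∈-++⁺ˡ; ∈-++⁺ʳ; ∈-++⁻)
open import Data.List.Relation.Binary.Subset.DecPropositional _≟ₚ_ using (_⊆?_)
open import Data.List.Relation.Binary.Subset.Propositional using (_⊆_)
open import Data.List.Relation.Binary.Subset.Propositional.Properties using (map⁺)
open import Data.List.Relation.Unary.All using (All; []; _∷_)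
import Data.List.Relation.Unary.All as All
import Data.List.Relation.Unary.All.Properties as Allₚ
open import Data.List.Relation.Unary.AllPairs using (AllPairs; []; _∷_)
import Data.List.Relation.Unary.AllPairs.Properties as AllPairsₚ
open import Data.List.Relation.Unary.Any using (here; there)
open import Data.List.Relation.Unary.Unique.Propositional using (Unique)
import Data.List.Relation.Unary.Unique.Propositional.Properties as Uniqueₚ
open import Data.Maybe using (just)
open import Data.Maybe.Properties using (just-injective)
open import Data.Product using (∃; ∃₂; _×_; _,_; proj₁; proj₂)
open import Data.Sum using (_⊎_; inj₁; inj₂; [_,_]′)
open import Function using (_∘_; _$_)
open import Relation.Binary.Definitions using () renaming (Decidable to Decidable₂)
open import Relation.Binary.PropositionalEquality hiding ([_])
open import Relation.Nullary using (¬_; contradiction; yes; no)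
open import Relation.Nullary.Decidable using (_×-dec_)
open import Relation.Unary using (Decidable)

-- Counting elements of lists

length-filter-map : ∀ {A B : Set} {P : B → Set} (P? : Decidable P) (f : A → B) xs →
  length (filter P? (map f xs)) ≡ length (filter (P? ∘ f) xs)
length-filter-map P? f []       = refl
length-filter-map P? f (x ∷ xs) with P? (f x)
... | yes _ = cong suc (length-filter-map P? f xs)
... | no  _ = length-filter-map P? f xs

length-filter-cong : ∀ {A : Set} {P Q : A → Set} (P? : Decidable P) (Q? : Decidable Q) {xs} →
  All (λ x → (P x → Q x) × (Q x → P x)) xs → length (filter P? xs) ≡ length (filter Q? xs)
length-filter-cong P? Q? []                        = refl
length-filter-cong P? Q? (_∷_ {x} (to , from) p⇔q) with P? x | Q? x
... | yes _ | yes _ = cong suc (length-filter-cong P? Q? p⇔q)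
... | no _  | no _  = length-filter-cong P? Q? p⇔q
... | yes p | no ¬q = contradiction (to p) ¬q
... | no ¬p | yes q = contradiction (from q) ¬p

length-filter-filter : ∀ {A : Set} {P Q : A → Set} (P? : Decidable P) (Q? : Decidable Q) xs →
  length (filter Q? (filter P? xs)) ≡ length (filter (λ x → P? x ×-dec Q? x) xs)
length-filter-filter P? Q? []       = refl
length-filter-filter P? Q? (x ∷ xs) with P? x
... | no _  = length-filter-filter P? Q? xs
... | yes _ with Q? x
...   | yes _ = cong suc (length-filter-filter P? Q? xs)
...   | no _  = length-filter-filter P? Q? xs

length-filter-⊎ : ∀ {A : Set} {P Q R : A → Set}
  (P? : Decidable P) (Q? : Decidable Q) (R? : Decidable R) →
  (∀ {x} → R x → P x ⊎ Q x) → (∀ {x} → P x → R x) → (∀ {x} → Q x → R x) → (∀ {x} → P x → ¬ Q x) →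
  ∀ xs → length (filter P? xs) + length (filter Q? xs) ≡ length (filter R? xs)
length-filter-⊎ P? Q? R? split fromP fromQ disjoint = go
  where
  go : ∀ xs → length (filter P? xs) + length (filter Q? xs) ≡ length (filter R? xs)
  go []       = refl
  go (x ∷ xs) with P? x | Q? x | R? x
  ... | yes p | yes q | _     = contradiction q (disjoint p)
  ... | yes p | no _  | yes _ = cong suc (go xs)
  ... | no _  | yes _ | yes _ = trans (+-suc _ _) (cong suc (go xs))
  ... | no _  | no _  | no _  = go xs
  ... | yes p | no _  | no ¬r = contradiction (fromP p) ¬r
  ... | no _  | yes q | no ¬r = contradiction (fromQ q) ¬r
  ... | no ¬p | no ¬q | yes r = ⊥-elim ([ ¬p , ¬q ]′ (split r))

∑<-suc : ∀ m f → ∑< (suc m) f ≡ ∑< m f + f m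
∑<-suc m f = begin
  sum (applyUpTo f (suc m))          ≡⟨ cong sum (applyUpTo-∷ʳ f m) ⟨
  sum (applyUpTo f m ++ [ f m ])     ≡⟨ sum-++ (applyUpTo f m) [ f m ] ⟩
  ∑< m f + (f m + 0)                 ≡⟨ cong (λ k → ∑< m f + k) (+-identityʳ (f m)) ⟩
  ∑< m f + f m                       ∎
  where open ≡-Reasoning

module _ {A : Set} (f : A → ℕ) {Q : A → Set} (Q? : Decidable Q) {P : ℕ → A → Set}
         (P? : ∀ j → Decidable (P j)) (to : ∀ {j x} → P j x → f x ≡ j × Q x)
         (from : ∀ {j x} → f x ≡ j × Q x → P j x) (xs : List A) where

  -- The fibres are filtered by predicates `P j` only equivalent to `f x ≡ j × Q x`, because an
  -- entry of the f-triangle tests length before degree, while `f` is the degree for column sums and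
  -- the length for row sums.
  ∑-fibres-below : ∀ m →
    ∑[ j < m ] length (filter (P? j) xs) ≡ length (filter (λ x → Q? x ×-dec (f x <? m)) xs)
  ∑-fibres-below zero = sym (cong length (filter-none (λ x → Q? x ×-dec (f x <? 0))
    (All.universal (λ _ ()) xs)))
  ∑-fibres-below (suc m) = begin
    ∑[ j < suc m ] length (filter (P? j) xs)
      ≡⟨ ∑<-suc m (λ j → length (filter (P? j) xs)) ⟩
    ∑[ j < m ] length (filter (P? j) xs) + length (filter (P? m) xs)
      ≡⟨ cong (_+ length (filter (P? m) xs)) (∑-fibres-below m) ⟩
    length (filter (λ x → Q? x ×-dec (f x <? m)) xs) + length (filter (P? m) xs)
      ≡⟨ length-filter-⊎ (λ x → Q? x ×-dec (f x <? m)) (P? m) (λ x → Q? x ×-dec (f x <? suc m))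
           split (λ (q , l) → q , m<n⇒m<1+n l)
           (λ p → proj₂ (to p) , s≤s (≤-reflexive (proj₁ (to p))))
           (λ (_ , l) p → <-irrefl (proj₁ (to p)) l) xs ⟩
    length (filter (λ x → Q? x ×-dec (f x <? suc m)) xs) ∎
    where
    open ≡-Reasoning
    split : ∀ {x} → Q x × f x < suc m → (Q x × f x < m) ⊎ P m x
    split (q , s≤s l) with m≤n⇒m<n∨m≡n l
    ... | inj₁ l′ = inj₁ (q , l′)
    ... | inj₂ e  = inj₂ (from (e , q))

  ∑-fibres : ∀ m → All (λ x → Q x → f x < m) xs →
    ∑[ j < m ] length (filter (P? j) xs) ≡ length (filter Q? xs)
  ∑-fibres m bounded = trans (∑-fibres-below m)
    (length-filter-cong (λ x → Q? x ×-dec (f x <? m)) Q? (All.map (λ b → proj₁ , λ q → q , b q) bounded))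

deduplicate-id : ∀ {A : Set} {R : A → A → Set} (R? : Decidable₂ R) {xs} →
  AllPairs (λ x y → ¬ R x y) xs → deduplicate R? xs ≡ xs
deduplicate-id R? []                     = refl
deduplicate-id R? {x ∷ xs} (x≢xs ∷ distinct)
  rewrite deduplicate-id R? distinct = cong (x ∷_) (filter-all _ x≢xs)

-- Counting paths by valleys

pascal : ∀ n k → n C k + n C suc k ≡ suc n C suc k
pascal = nCk+nC[k+1]≡[n+1]C[k+1]

-- Induction on `n` by Pascal's rule. It converts the factor n of the Narayana denominator into
-- shifts of the lower and upper index.
absorption : ∀ n k → suc k * (suc n C suc k) ≡ suc n * (n C k)
absorption zero    zero    = refl
absorption zero    (suc k)
  rewrite k>n⇒nCk≡0 {1} {2 + k} (s≤s (s≤s z≤n)) | k>n⇒nCk≡0 {0} {1 + k} (s≤s z≤n) = *-zeroʳ (2 + k)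
absorption (suc n) zero    rewrite nC1≡n (2 + n) = *-comm 1 (2 + n)
absorption (suc n) (suc k) = begin
  (2 + k) * (suc (suc n) C (2 + k))                         ≡⟨ cong ((2 + k) *_) (pascal (suc n) (suc k)) ⟨
  (2 + k) * (b + c)                                         ≡⟨ split k b c ⟩
  suc k * b + (2 + k) * c + b
    ≡⟨ cong₂ (λ x y → x + y + b) (absorption n k) (absorption n (suc k)) ⟩
  suc n * (n C k) + suc n * (n C suc k) + b
    ≡⟨ cong (_+ b) (*-distribˡ-+ (suc n) (n C k) (n C suc k)) ⟨
  suc n * (n C k + n C suc k) + b                           ≡⟨ cong (λ x → suc n * x + b) (pascal n k) ⟩
  suc n * b + b                                             ≡⟨ +-comm (suc n * b) b ⟩
  (2 + n) * b ∎
  where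
  open ≡-Reasoning
  b = suc n C suc k
  c = suc n C (2 + k)
  split : ∀ k b c → (2 + k) * (b + c) ≡ suc k * b + (2 + k) * c + b
  split = solve-∀

-- isPathWith w s h a k: preceded by the letter s, the word w leads from height h to 0
-- without going below 0, has a U's and completes k valleys.
isPathWith : Word → Step → ℕ → ℕ → ℕ → Bool
isPathWith []      s zero    zero    zero    = true
isPathWith (U ∷ w) U h       (suc a) k       = isPathWith w U (suc h) a k
isPathWith (U ∷ w) D h       (suc a) (suc k) = isPathWith w U (suc h) a k
isPathWith (D ∷ w) s (suc h) a       k       = isPathWith w D h a k
isPathWith _       _ _       _       _       = false

count : Step → ℕ → ℕ → ℕ → ℕ → ℕ
count s h a k m = length (filter (λ w → T? (isPathWith w s h a k)) (words m))

count-letter : ∀ {P : Word → Set} (P? : Decidable P) m →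
  length (filter P? (words (suc m)))
    ≡ length (filter (P? ∘ (U ∷_)) (words m)) + length (filter (P? ∘ (D ∷_)) (words m))
count-letter P? m
  rewrite filter-++ P? (map (U ∷_) (words m)) (map (D ∷_) (words m))
        | length-++ (filter P? (map (U ∷_) (words m))) {filter P? (map (D ∷_) (words m))}
        | length-filter-map P? (U ∷_) (words m)
        | length-filter-map P? (D ∷_) (words m) = refl

count-none : ∀ ws → length (filter {A = Word} (λ _ → T? false) ws) ≡ 0
count-none ws = cong length (filter-none (λ _ → T? false) (All.universal (λ _ ()) ws))

-- First of the recurrences by first letter. A U after a D uses up one valley; a branch vanishes
-- when it would descend below 0, complete a valley beyond the prescribed number, or rise with no
-- up-steps left.
count-U-ground : ∀ a k m → count U 0 (suc a) k (suc m) ≡ count U 1 a k m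
count-U-ground a k m = trans (count-letter (λ w → T? (isPathWith w U 0 (suc a) k)) m)
  (trans (cong (λ z → count U 1 a k m + z) (count-none (words m))) (+-identityʳ _))

count-U : ∀ h a k m →
  count U (suc h) (suc a) k (suc m) ≡ count U (2 + h) a k m + count D h (suc a) k m
count-U h a k m = count-letter (λ w → T? (isPathWith w U (suc h) (suc a) k)) m

count-D-ground : ∀ a k m → count D 0 (suc a) (suc k) (suc m) ≡ count U 1 a k m
count-D-ground a k m = trans (count-letter (λ w → T? (isPathWith w D 0 (suc a) (suc k))) m)
  (trans (cong (λ z → count U 1 a k m + z) (count-none (words m))) (+-identityʳ _))

count-D : ∀ h a k m →
  count D (suc h) (suc a) (suc k) (suc m) ≡ count U (2 + h) a k m + count D h (suc a) (suc k) m
count-D h a k m = count-letter (λ w → T? (isPathWith w D (suc h) (suc a) (suc k))) m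

count-D-ground-zero : ∀ a m → count D 0 (suc a) 0 (suc m) ≡ 0
count-D-ground-zero a m = trans (count-letter (λ w → T? (isPathWith w D 0 (suc a) 0)) m)
  (cong₂ _+_ (count-none (words m)) (count-none (words m)))

count-D-zero : ∀ h a m → count D (suc h) (suc a) 0 (suc m) ≡ count D h (suc a) 0 m
count-D-zero h a m = trans (count-letter (λ w → T? (isPathWith w D (suc h) (suc a) 0)) m)
  (cong (_+ count D h (suc a) 0 m) (count-none (words m)))

count-descent : ∀ s h k m → count s (suc h) 0 k (suc m) ≡ count D h 0 k m
count-descent U h k m = trans (count-letter (λ w → T? (isPathWith w U (suc h) 0 k)) m)
  (cong (_+ count D h 0 k m) (count-none (words m)))
count-descent D h k m = trans (count-letter (λ w → T? (isPathWith w D (suc h) 0 k)) m)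
  (cong (_+ count D h 0 k m) (count-none (words m)))

-- There are a up-steps and h + a down-steps. The word length stays a variable `m` equated to this,
-- so that `words m` unfolds one letter at a time.
pathLength : ℕ → ℕ → ℕ
pathLength h a = h + (a + a)

up-pathLength : ∀ h a {m} → suc m ≡ pathLength h (suc a) → m ≡ pathLength (suc h) a
up-pathLength h a e = suc-injective (trans e (lemma h a))
  where
  lemma : ∀ h a → h + (suc a + suc a) ≡ suc (suc h + (a + a))
  lemma = solve-∀

descents-zero : ∀ s h m → m ≡ pathLength h 0 → count s h 0 0 m ≡ 1
descents-zero U zero    .zero   refl = refl
descents-zero D zero    .zero   refl = refl
descents-zero s (suc h) (suc m) e    =
  trans (count-descent s h 0 m) (descents-zero D h m (suc-injective e))

descents-suc : ∀ s h k m → m ≡ pathLength h 0 → count s h 0 (suc k) m ≡ 0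
descents-suc U zero    k .zero   refl = refl
descents-suc D zero    k .zero   refl = refl
descents-suc s (suc h) k (suc m) e    =
  trans (count-descent s h (suc k) m) (descents-suc D h k m (suc-injective e))

-- After a D, the first remaining up-step completes a valley.
no-valley-D : ∀ h a m → m ≡ pathLength h (suc a) → count D h (suc a) 0 m ≡ 0
no-valley-D zero    a (suc m) e = count-D-ground-zero a m
no-valley-D (suc h) a (suc m) e = trans (count-D-zero h a m) (no-valley-D h a m (suc-injective e))

-- The one path takes all its up-steps first and then descends.
no-valley-U : ∀ h a m → m ≡ pathLength h a → count U h a 0 m ≡ 1
no-valley-U h       zero    m       e = descents-zero U h m e
no-valley-U zero    (suc a) (suc m) e =
  trans (count-U-ground a 0 m) (no-valley-U 1 a m (up-pathLength 0 a e))
no-valley-U (suc h) (suc a) (suc m) e = trans (count-U h a 0 m)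
  (cong₂ _+_ (no-valley-U (2 + h) a m (up-pathLength (suc h) a e)) (no-valley-D h a m (suc-injective e)))

-- Reflection formulas, with the subtracted term moved to the left-hand side.
-- The path has a up-steps and a + suc h (resp. suc a + h) down-steps left.
mutual
  closed-U : ∀ h a k m → m ≡ pathLength (suc h) a →
    count U (suc h) a (suc k) m + (suc a C (2 + k)) * ((a + h) C k)
      ≡ (a C suc k) * (suc (a + h) C suc k)
  closed-U h zero k m e
    rewrite descents-suc U (suc h) k m e
          | k>n⇒nCk≡0 {1} {2 + k} (s≤s (s≤s z≤n)) | k>n⇒nCk≡0 {0} {1 + k} (s≤s z≤n) = refl
  closed-U h (suc a) k (suc m) e = begin
    -- Pascal's rule splits the subtracted product so that each branch receives exactly the
    -- correction in its induction hypothesis.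
    count U (suc h) (suc a) (suc k) (suc m) + ((2 + a) C (2 + k)) * β
      ≡⟨ cong₂ (λ x y → x + y * β) (count-U h a (suc k) m) (sym (pascal (suc a) (suc k))) ⟩
    X + Y + (p + q) * β                                 ≡⟨ shuffle₁ X Y p q β ⟩
    (X + q * β) + (Y + p * β)                           ≡⟨ cong₂ _+_ IHU IHD ⟩
    (a C suc k) * γ + (a C k) * γ                       ≡⟨ shuffle₂ (a C suc k) (a C k) γ ⟩
    (a C k + a C suc k) * γ                             ≡⟨ cong (_* γ) (pascal a k) ⟩
    (suc a C suc k) * γ                                 ∎
    where
    open ≡-Reasoning
    X = count U (2 + h) a (suc k) m
    Y = count D h (suc a) (suc k) m
    p = suc a C suc k
    q = suc a C (2 + k)
    β = suc (a + h) C k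
    γ = suc (suc (a + h)) C suc k
    IHU : X + q * β ≡ (a C suc k) * γ
    IHU = subst (λ b → X + q * (b C k) ≡ (a C suc k) * (suc b C suc k)) (+-suc a h)
            (closed-U (suc h) a k m (up-pathLength (suc h) a e))
    IHD : Y + p * β ≡ (a C k) * γ
    IHD = closed-D h a k m (suc-injective e)
    shuffle₁ : ∀ X Y p q β → X + Y + (p + q) * β ≡ (X + q * β) + (Y + p * β)
    shuffle₁ = solve-∀
    shuffle₂ : ∀ x y γ → x * γ + y * γ ≡ (y + x) * γ
    shuffle₂ = solve-∀

  closed-D : ∀ h a k m → m ≡ pathLength h (suc a) →
    count D h (suc a) (suc k) m + (suc a C suc k) * (suc (a + h) C k)
      ≡ (a C k) * ((2 + (a + h)) C suc k)
  closed-D zero a zero (suc m) e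
    rewrite count-D-ground a 0 m | no-valley-U 1 a m (up-pathLength 0 a e)
          | nC1≡n (suc a) | +-identityʳ a | nC1≡n (2 + a) = lemma a
    where
    lemma : ∀ a → 1 + suc a * 1 ≡ 1 * (2 + a)
    lemma = solve-∀
  closed-D zero a (suc k) (suc m) e
    rewrite count-D-ground a (suc k) m | +-identityʳ a = begin
    -- At height 0 only the U branch exists. Splitting `p` leaves its correction `q * r` and a
    -- remainder `q * t` that completes the right-hand side.
    X + q * p                                    ≡⟨ cong (λ z → X + q * z) (pascal a k) ⟨
    X + q * (r + t)                              ≡⟨ shuffle₁ X q r t ⟩
    (X + q * r) + q * t                          ≡⟨ cong (_+ q * t) IHU ⟩
    t * p + q * t                                ≡⟨ shuffle₂ t p q ⟩
    t * (p + q)                                  ≡⟨ cong (t *_) (pascal (suc a) (suc k)) ⟩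
    t * ((2 + a) C (2 + k))                      ∎
    where
    open ≡-Reasoning
    X = count U 1 a (suc k) m
    p = suc a C suc k
    q = suc a C (2 + k)
    r = a C k
    t = a C suc k
    IHU : X + q * r ≡ t * p
    IHU = subst (λ b → X + q * (b C k) ≡ t * (suc b C suc k)) (+-identityʳ a)
            (closed-U 0 a k m (up-pathLength 0 a e))
    shuffle₁ : ∀ X q r t → X + q * (r + t) ≡ (X + q * r) + q * t
    shuffle₁ = solve-∀
    shuffle₂ : ∀ t p q → t * p + q * t ≡ t * (p + q)
    shuffle₂ = solve-∀
  -- A rise now spends the only valley, so that branch is valley-free, a case outside the formula
  -- for U; it contributes 1.
  closed-D (suc h) a zero (suc m) e
    rewrite count-D h a 0 m | no-valley-U (2 + h) a m (up-pathLength (suc h) a e) | +-suc a h =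
    trans (cong suc IHD) (lemma _ (nC1≡n (2 + (a + h))) (nC1≡n (3 + (a + h))))
    where
    IHD : count D h (suc a) 1 m + (suc a C 1) * 1 ≡ (a C 0) * ((2 + (a + h)) C 1)
    IHD = closed-D h a 0 m (suc-injective e)
    lemma : ∀ b {x y} → x ≡ b → y ≡ suc b → suc (1 * x) ≡ 1 * y
    lemma b refl refl = refl
  closed-D (suc h) a (suc k) (suc m) e rewrite count-D h a (suc k) m | +-suc a h = begin
    -- Both branches have the same first factor `q` in their corrections, so here Pascal's rule
    -- splits the second factor.
    X + Y + q * ((2 + (a + h)) C suc k)          ≡⟨ cong (λ z → X + Y + q * z) (pascal (suc (a + h)) k) ⟨
    X + Y + q * (r + t)                          ≡⟨ shuffle₁ X Y q r t ⟩
    (X + q * r) + (Y + q * t)                    ≡⟨ cong₂ _+_ IHU IHD ⟩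
    u * v + u * w                                ≡⟨ *-distribˡ-+ u v w ⟨
    u * (v + w)                                  ≡⟨ cong (u *_) (pascal (2 + (a + h)) (suc k)) ⟩
    u * ((3 + (a + h)) C (2 + k))                ∎
    where
    open ≡-Reasoning
    X = count U (2 + h) a (suc k) m
    Y = count D h (suc a) (2 + k) m
    q = suc a C (2 + k)
    r = suc (a + h) C k
    t = suc (a + h) C suc k
    u = a C suc k
    v = (2 + (a + h)) C suc k
    w = (2 + (a + h)) C (2 + k)
    IHU : X + q * r ≡ u * v
    IHU = subst (λ b → X + q * (b C k) ≡ u * (suc b C suc k)) (+-suc a h)
            (closed-U (suc h) a k m (up-pathLength (suc h) a e))
    IHD : Y + q * t ≡ u * w
    IHD = closed-D h a (suc k) m (suc-injective e)
    shuffle₁ : ∀ X Y q r t → X + Y + q * (r + t) ≡ (X + q * r) + (Y + q * t)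
    shuffle₁ = solve-∀

-- The first letter is U, so for at least one valley the reflection formula applies at height 1.
-- After multiplication by `suc n`, absorption turns its two products into multiples of `b * c`
-- whose coefficients differ by 1.
narayana-count : ∀ n k m → m ≡ pathLength 0 (suc n) →
  count U 0 (suc n) k m * suc n ≡ (suc n C suc k) * (suc n C k)
narayana-count n zero m e rewrite no-valley-U 0 (suc n) m e | nC1≡n (suc n) = *-comm 1 (suc n)
narayana-count n (suc k) (suc m) e rewrite count-U-ground n (suc k) m =
  +-cancelʳ-≡ (suc k * c * b) _ _ (begin
    X * suc n + suc k * c * b              ≡⟨ cong (λ z → X * suc n + z * b) (absorption n k) ⟩
    X * suc n + suc n * r * b              ≡⟨ shuffle₁ X n r b ⟩
    suc n * (X + b * r)                    ≡⟨ cong (suc n *_) IH ⟩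
    suc n * (t * c)                        ≡⟨ *-assoc (suc n) t c ⟨
    suc n * t * c                          ≡⟨ cong (_* c) (absorption n (suc k)) ⟨
    (2 + k) * b * c                        ≡⟨ shuffle₂ k b c ⟩
    b * c + suc k * c * b                  ∎)
  where
  open ≡-Reasoning
  X = count U 1 n (suc k) m
  b = suc n C (2 + k)
  c = suc n C suc k
  r = n C k
  t = n C suc k
  IH : X + b * r ≡ t * c
  IH = subst (λ z → X + b * (z C k) ≡ t * (suc z C suc k)) (+-identityʳ n)
         (closed-U 0 n k m (up-pathLength 0 n e))
  shuffle₁ : ∀ X n r b → X * suc n + suc n * r * b ≡ suc n * (X + b * r)
  shuffle₁ = solve-∀
  shuffle₂ : ∀ k b c → (2 + k) * b * c ≡ b * c + suc k * c * b
  shuffle₂ = solve-∀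

-- Dyck paths and their valleys

#U-++ : ∀ v w → #U (v ++ w) ≡ #U v + #U w
#U-++ v w = trans (cong length (filter-++ (U ≟ₛ_) v w)) (length-++ (filter (U ≟ₛ_) v))

#D-++ : ∀ v w → #D (v ++ w) ≡ #D v + #D w
#D-++ v w = trans (cong length (filter-++ (D ≟ₛ_) v w)) (length-++ (filter (D ≟ₛ_) v))

length≡#U+#D : ∀ w → length w ≡ #U w + #D w
length≡#U+#D []      = refl
length≡#U+#D (U ∷ w) = cong suc (length≡#U+#D w)
length≡#U+#D (D ∷ w) = trans (cong suc (length≡#U+#D w)) (sym (+-suc (#U w) (#D w)))

-- Path h a w: the word w leads from height h to 0 without going below 0 and has a U's.
data Path : ℕ → ℕ → Word → Set where
  end  : Path 0 0 []
  up   : ∀ {h a w} → Path (suc h) a w → Path h (suc a) (U ∷ w)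
  down : ∀ {h a w} → Path h a w → Path (suc h) a (D ∷ w)

Path⇒#U : ∀ {h a w} → Path h a w → #U w ≡ a
Path⇒#U end      = refl
Path⇒#U (up p)   = cong suc (Path⇒#U p)
Path⇒#U (down p) = Path⇒#U p

Path⇒#D : ∀ {h a w} → Path h a w → #D w ≡ h + a
Path⇒#D end                = refl
Path⇒#D (up {h} {a} p)     = trans (Path⇒#D p) (sym (+-suc h a))
Path⇒#D (down p)           = cong suc (Path⇒#D p)

Path⇒length : ∀ {h a w} → Path h a w → length w ≡ h + (a + a)
Path⇒length {h} {a} {w} p = begin
  length w       ≡⟨ length≡#U+#D w ⟩
  #U w + #D w    ≡⟨ cong₂ _+_ (Path⇒#U p) (Path⇒#D p) ⟩
  a + (h + a)    ≡⟨ +-assoc a h a ⟨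
  a + h + a      ≡⟨ cong (_+ a) (+-comm a h) ⟩
  h + a + a      ≡⟨ +-assoc h a a ⟩
  h + (a + a)    ∎
  where open ≡-Reasoning

Path⇒prefixes : ∀ {h a w} → Path h a w → All (λ p → #D p ≤ h + #U p) (inits w)
Path⇒prefixes end        = z≤n ∷ []
Path⇒prefixes (up {h} p) = z≤n ∷
  Allₚ.map⁺ (All.map (λ {v} → subst (#D v ≤_) (sym (+-suc h (#U v)))) (Path⇒prefixes p))
Path⇒prefixes (down p)   = z≤n ∷ Allₚ.map⁺ (All.map s≤s (Path⇒prefixes p))

prefixes⇒Path : ∀ h w → h + #U w ≡ #D w → All (λ p → #D p ≤ h + #U p) (inits w) → Path h (#U w) w
prefixes⇒Path zero    []      e  _        = end
prefixes⇒Path (suc h) []      () _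
prefixes⇒Path h       (U ∷ w) e  (_ ∷ ps) = up (prefixes⇒Path (suc h) w
  (trans (sym (+-suc h (#U w))) e)
  (All.map (λ {v} → subst (#D v ≤_) (+-suc h (#U v))) (Allₚ.map⁻ ps)))
prefixes⇒Path zero    (D ∷ w) e  (_ ∷ () ∷ _)
prefixes⇒Path (suc h) (D ∷ w) e  (_ ∷ ps) = down (prefixes⇒Path h w
  (suc-injective e) (All.map ≤-pred (Allₚ.map⁻ ps)))

∈-words⁻ : ∀ m {w} → w ∈ words m → length w ≡ m
∈-words⁻ zero    (here refl) = refl
∈-words⁻ (suc m) w∈ with ∈-++⁻ (map (U ∷_) (words m)) w∈
... | inj₁ w∈U with ∈-map⁻ (U ∷_) w∈U
...   | _ , v∈ , refl = cong suc (∈-words⁻ m v∈)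
∈-words⁻ (suc m) w∈ | inj₂ w∈D with ∈-map⁻ (D ∷_) w∈D
...   | _ , v∈ , refl = cong suc (∈-words⁻ m v∈)

∈-words⁺ : ∀ w → w ∈ words (length w)
∈-words⁺ []      = here refl
∈-words⁺ (U ∷ w) = ∈-++⁺ˡ (∈-map⁺ (U ∷_) (∈-words⁺ w))
∈-words⁺ (D ∷ w) = ∈-++⁺ʳ _ (∈-map⁺ (D ∷_) (∈-words⁺ w))

words-unique : ∀ m → Unique (words m)
words-unique zero    = [] ∷ []
words-unique (suc m) = Uniqueₚ.++⁺
  (Uniqueₚ.map⁺ ∷-injectiveʳ (words-unique m)) (Uniqueₚ.map⁺ ∷-injectiveʳ (words-unique m)) disjoint
  where
  disjoint : ∀ {v} → ¬ (v ∈ map (U ∷_) (words m) × v ∈ map (D ∷_) (words m))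
  disjoint (v∈U , v∈D) with ∈-map⁻ (U ∷_) v∈U | ∈-map⁻ (D ∷_) v∈D
  ... | _ , _ , refl | _ , _ , ()

double : ∀ n → 2 * n ≡ n + n
double n = cong (λ z → n + z) (+-identityʳ n)

IsDyck⇒Path : ∀ n {w} → length w ≡ 2 * n → IsDyck w → Path 0 n w
IsDyck⇒Path n {w} len (#U≡#D , prefixes) =
  subst (λ a → Path 0 a w) (*-cancelˡ-≡ (#U w) n 2 (begin
    2 * #U w       ≡⟨ double (#U w) ⟩
    #U w + #U w    ≡⟨ cong (λ z → #U w + z) #U≡#D ⟩
    #U w + #D w    ≡⟨ length≡#U+#D w ⟨
    length w       ≡⟨ len ⟩
    2 * n          ∎))
    (prefixes⇒Path 0 w #U≡#D prefixes)
  where open ≡-Reasoning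

Path⇒IsDyck : ∀ {n w} → Path 0 n w → IsDyck w
Path⇒IsDyck p = trans (Path⇒#U p) (sym (Path⇒#D p)) , Path⇒prefixes p

∈-Dyck⁻ : ∀ n {w} → w ∈ Dyck n → Path 0 n w
∈-Dyck⁻ n w∈ with ∈-filter⁻ isDyck? {xs = words (2 * n)} w∈
... | w∈words , dyck = IsDyck⇒Path n (∈-words⁻ (2 * n) w∈words) dyck

∈-Dyck⁺ : ∀ {n w} → Path 0 n w → w ∈ Dyck n
∈-Dyck⁺ {n} {w} p = ∈-filter⁺ isDyck?
  (subst (λ m → w ∈ words m) (trans (Path⇒length p) (sym (double n))) (∈-words⁺ w)) (Path⇒IsDyck p)

-- Valleys as pairs (number of U's, number of D's) read so far.  In valleys s x y w
-- the letter s precedes w, and the prefix ending in s has x U's and y D's.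

Lattice : Set
Lattice = ℕ × ℕ

position : Lattice → Position
position (x , y) = x + y , x ⊖ y

valleys : Step → ℕ → ℕ → Word → List Lattice
valleys s x y []      = []
valleys s x y (D ∷ w) = valleys D x (suc y) w
valleys D x y (U ∷ w) = (x , y) ∷ valleys U (suc x) y w
valleys U x y (U ∷ w) = valleys U (suc x) y w

-- The empty prefix behaves like one ending in U.
data EndsIn : Word → Step → Set where
  empty : EndsIn [] U
  snoc  : ∀ v s → EndsIn (v ∷ʳ s) s

‼-next : ∀ v s w → (v ++ s ∷ w) ‼ suc (length v) ≡ just s
‼-next []      s w = refl
‼-next (_ ∷ v) s w = ‼-next v s w

length-∷ʳ : ∀ (v : Word) s → length (v ∷ʳ s) ≡ suc (length v)
length-∷ʳ v s = trans (length-++ v) (+-comm (length v) 1)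

‼-last : ∀ v s w → ((v ∷ʳ s) ++ w) ‼ length (v ∷ʳ s) ≡ just s
‼-last v s w rewrite length-∷ʳ v s | ++-assoc v [ s ] w = ‼-next v s w

-- Letters are numbered from 1, so index `length v` is the last letter of `v`. For empty `v` it is
-- 0, where there is no letter, in accordance with the convention that the empty prefix ends in U.
EndsIn⇒≡D : ∀ {v s} w → EndsIn v s → (v ++ w) ‼ length v ≡ just D → s ≡ D
EndsIn⇒≡D []      empty      ()
EndsIn⇒≡D (_ ∷ _) empty      ()
EndsIn⇒≡D w       (snoc v s) e = just-injective (trans (sym (‼-last v s w)) e)

≡D⇒EndsIn : ∀ {v s} w → EndsIn v s → s ≡ D → (v ++ w) ‼ length v ≡ just D
≡D⇒EndsIn w (snoc v D) refl = ‼-last v D w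

-- The tails of `upTo`, in a form that recurses on the starting point.
range : ℕ → ℕ → List ℕ
range i zero    = []
range i (suc m) = i ∷ range (suc i) m

applyUpTo≡range : ∀ i f m → (∀ j → f j ≡ i + j) → applyUpTo f m ≡ range i m
applyUpTo≡range i f zero    f≗ = refl
applyUpTo≡range i f (suc m) f≗ = cong₂ _∷_ (trans (f≗ 0) (+-identityʳ i))
  (applyUpTo≡range (suc i) (f ∘ suc) m (λ j → trans (f≗ (suc j)) (+-suc i j)))

take-length : ∀ (v w : Word) → take (length v) (v ++ w) ≡ v
take-length []      w = refl
take-length (s ∷ v) w = cong (s ∷_) (take-length v w)

drop-length : ∀ (v w : Word) → drop (length v) (v ++ w) ≡ w
drop-length []      w = refl
drop-length (s ∷ v) w = drop-length v w

-- Induction on the unread part `w`, with `v` already read. The data of `v` enter through equations,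
-- so that passing a letter from `w` to `v` only requires reassociating.
V-from : ∀ {s} v w full i x y → EndsIn v s →
  full ≡ v ++ w → i ≡ length v → x ≡ #U v → y ≡ #D v →
  map (λ j → j , height full j) (filter (isValley? full) (range i (length w)))
    ≡ map position (valleys s x y w)
V-from v [] full i x y ends _ _ _ _ = refl
V-from {D} v (U ∷ w) full i x y ends refl refl refl refl = begin
  map at (filter valley? (length v ∷ rest))
    ≡⟨ cong (map at) (filter-accept valley? (≡D⇒EndsIn (U ∷ w) ends refl , ‼-next v U w)) ⟩
  at (length v) ∷ map at (filter valley? rest)
    ≡⟨ cong₂ _∷_ (cong₂ _,_ (length≡#U+#D v) (cong (λ z → #U z ⊖ #D z) (take-length v (U ∷ w))))
         (V-from (v ∷ʳ U) w full (suc (length v)) (suc x) y (snoc v U)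
           (sym (++-assoc v [ U ] w)) (sym (length-∷ʳ v U))
           (trans (+-comm 1 (#U v)) (sym (#U-++ v [ U ]))) (trans (sym (+-identityʳ (#D v))) (sym (#D-++ v [ U ])))) ⟩
  position (x , y) ∷ map position (valleys U (suc x) y w) ∎
  where
  open ≡-Reasoning
  valley? = isValley? full
  at = λ j → j , height full j
  rest = range (suc (length v)) (length w)
V-from {U} v (U ∷ w) full i x y ends refl refl refl refl = trans
  (cong (map _) (filter-reject (isValley? full) (λ where (e , _) → contradiction (EndsIn⇒≡D (U ∷ w) ends e) λ ())))
  (V-from (v ∷ʳ U) w full (suc (length v)) (suc x) y (snoc v U)
    (sym (++-assoc v [ U ] w)) (sym (length-∷ʳ v U))
    (trans (+-comm 1 (#U v)) (sym (#U-++ v [ U ]))) (trans (sym (+-identityʳ (#D v))) (sym (#D-++ v [ U ]))))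
V-from {s} v (D ∷ w) full i x y ends refl refl refl refl = trans
  (cong (map _) (filter-reject (isValley? full) (λ where (_ , e) → contradiction (trans (sym (‼-next v D w)) e) λ ())))
  (V-from (v ∷ʳ D) w full (suc (length v)) x (suc y) (snoc v D)
    (sym (++-assoc v [ D ] w)) (sym (length-∷ʳ v D))
    (trans (sym (+-identityʳ (#U v))) (sym (#U-++ v [ D ]))) (trans (+-comm 1 (#D v)) (sym (#D-++ v [ D ]))))

V≡valleys : ∀ w → V w ≡ map position (valleys U 0 0 w)
V≡valleys w = trans
  (cong (λ l → map (λ i → i , height w i) (filter (isValley? w) l))
    (applyUpTo≡range 0 (λ j → j) (length w) (λ _ → refl)))
  (V-from [] w w 0 0 0 empty refl refl refl refl)

-- The sum of min{uᵢ , dᵢ}, where the current portion already has u U's and d D's.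
portionMins : Step → ℕ → ℕ → Word → ℕ
portionMins s u d []      = u ⊓ d
portionMins s u d (D ∷ w) = portionMins D u (suc d) w
portionMins D u d (U ∷ w) = u ⊓ d + portionMins U 1 0 w
portionMins U u d (U ∷ w) = portionMins U (suc u) d w

portion-++ : ∀ v t w b → b ≡ length v + length t → portion (v ++ t ++ w) (length v) b ≡ t
portion-++ v t w _ refl
  rewrite drop-length v (t ++ w) | m+n∸m≡n (length v) (length t) = take-length t w

-- Here `v` ends at the last listed point, `t` is the part of the current portion already read and
-- `w` is unread. At a valley `t` joins `v` and a new portion starts with U; the terminal point
-- closes the last portion. The height `z` is arbitrary since only abscissas determine portions.
sumMin-from : ∀ s v t w full x y z → full ≡ v ++ t ++ w → x + y ≡ length v + length t →
  sumMin full ((length v , z) ∷ map position (valleys s x y w) ++ [ length full , 0ℤ ])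
    ≡ portionMins s (#U t) (#D t) w
sumMin-from s v t [] full x y z refl _
  rewrite portion-++ v t [] (length full) (trans (length-++ v) (cong (λ r → length v + length r) (++-identityʳ t)))
  = +-identityʳ _
sumMin-from D v t (U ∷ w) full x y z refl e
  rewrite portion-++ v t (U ∷ w) (x + y) e = cong (λ z → #U t ⊓ #D t + z)
  (trans (cong (λ b → sumMin full ((b , x ⊖ y) ∷ map position (valleys U (suc x) y w) ++ [ length full , 0ℤ ]))
            (trans e (sym (length-++ v))))
    (sumMin-from U (v ++ t) [ U ] w full (suc x) y (x ⊖ y) (sym (++-assoc v t (U ∷ w)))
      (trans (cong suc (trans e (sym (length-++ v)))) (+-comm 1 _))))
sumMin-from U v t (U ∷ w) full x y z refl e = trans
  (sumMin-from U v (t ∷ʳ U) w full (suc x) y z (cong (v ++_) (sym (++-assoc t [ U ] w)))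
    (trans (cong suc e) (trans (sym (+-suc (length v) (length t)))
      (cong (λ z → length v + z) (sym (length-∷ʳ t U))))))
  (cong₂ (λ u d → portionMins U u d w)
    (trans (#U-++ t [ U ]) (+-comm _ 1)) (trans (#D-++ t [ U ]) (+-identityʳ _)))
sumMin-from s v t (D ∷ w) full x y z refl e = trans
  (sumMin-from D v (t ∷ʳ D) w full x (suc y) z (cong (v ++_) (sym (++-assoc t [ D ] w)))
    (trans (+-suc x y) (trans (cong suc e) (trans (sym (+-suc (length v) (length t)))
      (cong (λ z → length v + z) (sym (length-∷ʳ t D)))))))
  (cong₂ (λ u d → portionMins D u d w)
    (trans (#U-++ t [ D ]) (+-identityʳ _)) (trans (#D-++ t [ D ]) (+-comm _ 1)))

μ≡portionMins : ∀ w → μ w ≡ portionMins U 0 0 w ⊖ 1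
μ≡portionMins w rewrite V≡valleys w = cong (_⊖ 1) (sumMin-from U [] [] w w 0 0 0ℤ refl refl)

-- Recovering a path from its valley set

valleys-≥#U : ∀ s x y w {z} → z ∈ valleys s x y w → x ≤ proj₁ z
valleys-≥#U U x y (U ∷ w) z∈         = ≤-trans (n≤1+n x) (valleys-≥#U U (suc x) y w z∈)
valleys-≥#U D x y (U ∷ w) (here refl) = ≤-refl
valleys-≥#U D x y (U ∷ w) (there z∈) = ≤-trans (n≤1+n x) (valleys-≥#U U (suc x) y w z∈)
valleys-≥#U s x y (D ∷ w) z∈         = valleys-≥#U D x (suc y) w z∈

valleys-≥#D : ∀ s x y w {z} → z ∈ valleys s x y w → y ≤ proj₂ z
valleys-≥#D U x y (U ∷ w) z∈         = valleys-≥#D U (suc x) y w z∈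
valleys-≥#D D x y (U ∷ w) (here refl) = ≤-refl
valleys-≥#D D x y (U ∷ w) (there z∈) = valleys-≥#D U (suc x) y w z∈
valleys-≥#D s x y (D ∷ w) z∈         = ≤-trans (n≤1+n y) (valleys-≥#D D x (suc y) w z∈)

valleys-≤#U : ∀ s x y w {z} → z ∈ valleys s x y w → proj₁ z ≤ x + #U w
valleys-≤#U U x y (U ∷ w) {z} z∈     = subst (proj₁ z ≤_) (sym (+-suc x (#U w))) (valleys-≤#U U (suc x) y w z∈)
valleys-≤#U D x y (U ∷ w) (here refl) = m≤m+n x _
valleys-≤#U D x y (U ∷ w) {z} (there z∈) = subst (proj₁ z ≤_) (sym (+-suc x (#U w))) (valleys-≤#U U (suc x) y w z∈)
valleys-≤#U s x y (D ∷ w) z∈         = valleys-≤#U D x (suc y) w z∈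

-- The next U comes right after a D, and no U is read before it, so the first coordinate is still
-- `x`.
first-valley : ∀ {h a w} x y → Path h (suc a) w → ∃ λ y′ → (x , y′) ∈ valleys D x y w
first-valley x y (up p)   = y , here refl
first-valley x y (down p) = first-valley x (suc y) p

∉-later : ∀ s x y w {y′} → ¬ ((x , y′) ∈ valleys s (suc x) y w)
∉-later s x y w z∈ = <-irrefl refl (valleys-≥#U s (suc x) y w z∈)

-- The descending path has a valley with first coordinate `x` and second coordinate above `y`. The
-- rising path can have only (x , y) itself with that first coordinate; all its later valleys have
-- seen another U.
rise≢descent : ∀ {h a} s x y {v w} → Path (suc h) (suc a) (D ∷ w) →
  ¬ (valleys s x y (D ∷ w) ⊆ valleys s x y (U ∷ v))
rise≢descent s x y (down q) ⊆v with first-valley x (suc y) q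
rise≢descent U x y {v} (down q) ⊆v | y′ , z∈ = ∉-later U x y v (⊆v z∈)
rise≢descent D x y {v} {w} (down q) ⊆v | y′ , z∈ with ⊆v z∈
... | here refl = <-irrefl refl (valleys-≥#D D x (suc y) w z∈)
... | there z∈′ = ∉-later U x y v z∈′

⊆-tail : ∀ x y v w → valleys D x y (U ∷ v) ⊆ valleys D x y (U ∷ w) →
  valleys U (suc x) y v ⊆ valleys U (suc x) y w
⊆-tail x y v w ⊆w z∈ with ⊆w (there z∈)
... | here refl = contradiction z∈ (∉-later U x y v)
... | there z∈′ = z∈′

-- The words are read in parallel, and the inclusions pass to the tails as long as the letters
-- agree. At a first difference, the inclusion that starts from the descending path is contradicted.
valleys-injective : ∀ {h a} s x y {v w} → Path h a v → Path h a w →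
  valleys s x y v ⊆ valleys s x y w → valleys s x y w ⊆ valleys s x y v → v ≡ w
valleys-injective s x y end end _ _ = refl
valleys-injective U x y (up p) (up q) ⊆w ⊆v = cong (U ∷_) (valleys-injective U (suc x) y p q ⊆w ⊆v)
valleys-injective D x y (up {w = v} p) (up {w = w} q) ⊆w ⊆v =
  cong (U ∷_) (valleys-injective U (suc x) y p q (⊆-tail x y v w ⊆w) (⊆-tail x y w v ⊆v))
valleys-injective s x y (down p) (down q) ⊆w ⊆v =
  cong (D ∷_) (valleys-injective D x (suc y) p q ⊆w ⊆v)
valleys-injective s x y (up p) (down q) ⊆w ⊆v = ⊥-elim (rise≢descent s x y (down q) ⊆v)
valleys-injective s x y (down p) (up q) ⊆w ⊆v = ⊥-elim (rise≢descent s x y (down p) ⊆w)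

-- Refining a path

-- LastD s w: the nonempty word s ∷ w ends in D.
data LastD : Step → Word → Set where
  []  : LastD D []
  _∷_ : ∀ {s w} t → LastD t w → LastD s (t ∷ w)

Path⇒LastD : ∀ {h a w} → Path h a w → LastD D w
Path⇒LastD⁺ : ∀ {h a w} s → Path (suc h) a w → LastD s w
Path⇒LastD end      = []
Path⇒LastD (up p)   = U ∷ Path⇒LastD⁺ U p
Path⇒LastD (down p) = D ∷ Path⇒LastD p
Path⇒LastD⁺ s (up p)   = U ∷ Path⇒LastD⁺ U p
Path⇒LastD⁺ s (down p) = D ∷ Path⇒LastD p

LastD-++⁻ : ∀ {s t} v {w} → LastD s (v ++ t ∷ w) → LastD t w
LastD-++⁻ []      (_ ∷ l) = l
LastD-++⁻ (_ ∷ v) (_ ∷ l) = LastD-++⁻ v l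

#valleys≤#U : ∀ s x y w → length (valleys s x y w) ≤ #U w
#valleys≤#U s x y []      = z≤n
#valleys≤#U U x y (U ∷ w) = ≤-trans (#valleys≤#U U (suc x) y w) (n≤1+n _)
#valleys≤#U D x y (U ∷ w) = s≤s (#valleys≤#U U (suc x) y w)
#valleys≤#U s x y (D ∷ w) = #valleys≤#U D x (suc y) w

-- Each valley has its own D immediately before it, possibly `s` itself, and the final D precedes no
-- valley.
#valleys<#D : ∀ {s w} x y → LastD s w → length (valleys s x y w) < #D (s ∷ w)
#valleys<#D     x y []      = s≤s z≤n
#valleys<#D {U} x y (U ∷ l) = #valleys<#D (suc x) y l
#valleys<#D {D} x y (U ∷ l) = s≤s (#valleys<#D (suc x) y l)
#valleys<#D {U} x y (D ∷ l) = #valleys<#D x (suc y) l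
#valleys<#D {D} x y (D ∷ l) = ≤-trans (#valleys<#D x (suc y) l) (n≤1+n _)

valleys-++ : ∀ {s v} x y w → LastD s v →
  valleys s x y (v ++ w) ≡ valleys s x y v ++ valleys D (x + #U v) (y + #D v) w
valleys-++ x y w [] rewrite +-identityʳ x | +-identityʳ y = refl
valleys-++ {U} {U ∷ v} x y w (U ∷ l) rewrite +-suc x (#U v) = valleys-++ (suc x) y w l
valleys-++ {D} {U ∷ v} x y w (U ∷ l) rewrite +-suc x (#U v) = cong ((x , y) ∷_) (valleys-++ (suc x) y w l)
valleys-++ {s} {D ∷ v} x y w (D ∷ l) rewrite +-suc y (#D v) = valleys-++ x (suc y) w l

split-at-valley : ∀ s x y w {x′ y′} → (x′ , y′) ∈ valleys s x y w →
  ∃₂ λ v₁ v₂ → w ≡ v₁ ++ U ∷ v₂ × LastD s v₁ × x + #U v₁ ≡ x′ × y + #D v₁ ≡ y′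
split-at-valley U x y (U ∷ w) z∈ with split-at-valley U (suc x) y w z∈
... | v₁ , v₂ , refl , l , ex , ey = U ∷ v₁ , v₂ , refl , U ∷ l , trans (+-suc x (#U v₁)) ex , ey
split-at-valley D x y (U ∷ w) (here refl) = [] , w , refl , [] , +-identityʳ x , +-identityʳ y
split-at-valley D x y (U ∷ w) (there z∈) with split-at-valley U (suc x) y w z∈
... | v₁ , v₂ , refl , l , ex , ey = U ∷ v₁ , v₂ , refl , U ∷ l , trans (+-suc x (#U v₁)) ex , ey
split-at-valley s x y (D ∷ w) z∈ with split-at-valley D x (suc y) w z∈
... | v₁ , v₂ , refl , l , ex , ey = D ∷ v₁ , v₂ , refl , D ∷ l , ex , trans (+-suc y (#D v₁)) ey

-- U ∷ v starts at (a , b), as does the portion of w with u U's and d D's that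
-- has been read before the rest w.
#valleys<portionMins : ∀ w s u d a b {x y} v → x ≡ a + u → y ≡ b + d →
  valleys s x y w ⊆ valleys U (suc a) b v →
  suc (#U v) ≡ u + #U w → #D v ≡ d + #D w → LastD U v →
  length (valleys U (suc a) b v) < portionMins s u d w
#valleys<portionMins [] s u d a b v _ _ _ eU eD l = ⊓-glb
  (subst (_ ≤_) (trans eU (+-identityʳ u)) (s≤s (#valleys≤#U U (suc a) b v)))
  (subst (_ ≤_) (trans eD (+-identityʳ d)) (#valleys<#D (suc a) b l))
#valleys<portionMins (D ∷ w) s u d a b v ex ey ⊆v eU eD l =
  #valleys<portionMins w D u (suc d) a b v ex (trans (cong suc ey) (sym (+-suc b d))) ⊆v
    eU (trans eD (+-suc d (#D w))) l
#valleys<portionMins (U ∷ w) U u d a b v ex ey ⊆v eU eD l =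
  #valleys<portionMins w U (suc u) d a b v (trans (cong suc ex) (sym (+-suc a u))) ey ⊆v
    (trans eU (+-suc u (#U w))) eD l
-- The valley (x , y) closing this portion of `w` is also a valley of the other word, which is cut
-- there into `v₁` and `U ∷ v₂`.
#valleys<portionMins (U ∷ w) D u d a b {x} {y} v ex ey ⊆v eU eD l
  with split-at-valley U (suc a) b v (⊆v (here refl))
... | v₁ , v₂ , refl , l₁ , ex₁ , ey₁ =
  -- Of the two units gained from the strict bounds, one pays for the valley at the cut and the
  -- other keeps the sum strict.
  subst (_< u ⊓ d + portionMins U 1 0 w) (sym length-split) (+-mono-≤ bound₁ bound₂)
  where
  open ≡-Reasoning
  eu : suc (#U v₁) ≡ u
  eu = +-cancelˡ-≡ a _ _ (trans (+-suc a (#U v₁)) (trans ex₁ ex))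
  ed : #D v₁ ≡ d
  ed = +-cancelˡ-≡ b _ _ (trans ey₁ ey)
  split : valleys U (suc a) b (v₁ ++ U ∷ v₂) ≡ valleys U (suc a) b v₁ ++ (x , y) ∷ valleys U (suc x) y v₂
  split = trans (valleys-++ (suc a) b (U ∷ v₂) l₁)
    (cong₂ (λ p q → valleys U (suc a) b v₁ ++ valleys D p q (U ∷ v₂)) ex₁ ey₁)
  length-split : length (valleys U (suc a) b (v₁ ++ U ∷ v₂))
    ≡ length (valleys U (suc a) b v₁) + suc (length (valleys U (suc x) y v₂))
  length-split = trans (cong length split) (length-++ (valleys U (suc a) b v₁))
  bound₁ : length (valleys U (suc a) b v₁) < u ⊓ d
  bound₁ = ⊓-glb (subst (_ ≤_) eu (s≤s (#valleys≤#U U (suc a) b v₁)))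
                 (subst (_ ≤_) ed (#valleys<#D (suc a) b l₁))
  -- The later valleys of `w` have more than `x` U's before them, those inside `v₁` at most `x` and
  -- the cut exactly `x`.
  ⊆v₂ : valleys U (suc x) y w ⊆ valleys U (suc x) y v₂
  ⊆v₂ z∈ with ∈-++⁻ (valleys U (suc a) b v₁) (subst (_ ∈_) split (⊆v (there z∈)))
  ... | inj₁ z∈v₁ = contradiction (≤-trans (valleys-≥#U U (suc x) y w z∈)
                      (subst (_ ≤_) ex₁ (valleys-≤#U U (suc a) b v₁ z∈v₁))) (<-irrefl refl)
  ... | inj₂ (here refl) = contradiction z∈ (∉-later U x y w)
  ... | inj₂ (there z∈v₂) = z∈v₂
  bound₂ : length (valleys U (suc x) y v₂) < portionMins U 1 0 w
  bound₂ = #valleys<portionMins w U 1 0 x y v₂ (+-comm 1 x) (sym (+-identityʳ y)) ⊆v₂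
    (+-cancelˡ-≡ u _ _ (begin
      u + suc (#U v₂)             ≡⟨ cong (_+ suc (#U v₂)) eu ⟨
      suc (#U v₁ + suc (#U v₂))   ≡⟨ cong suc (#U-++ v₁ (U ∷ v₂)) ⟨
      suc (#U (v₁ ++ U ∷ v₂))     ≡⟨ eU ⟩
      u + suc (#U w)              ∎))
    (+-cancelˡ-≡ d _ _ (begin
      d + #D v₂                   ≡⟨ cong (_+ #D v₂) ed ⟨
      #D v₁ + #D v₂               ≡⟨ #D-++ v₁ (U ∷ v₂) ⟨
      #D (v₁ ++ U ∷ v₂)           ≡⟨ eD ⟩
      d + #D w                    ∎))
    (LastD-++⁻ v₁ l)

-- zigzag u d is the word with 1 + u U's and 1 + d D's with the most valleys
-- among those starting with U and ending in D.
zigzag : ℕ → ℕ → Word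
zigzag zero    d       = U ∷ replicate (suc d) D
zigzag (suc u) zero    = U ∷ zigzag u zero
zigzag (suc u) (suc d) = U ∷ D ∷ zigzag u d

-- refineU u w and refineD u d w replace every portion of U^{1+u} w, respectively of
-- U^{1+u} D^{1+d} w, by a zigzag.
refineU : ℕ → Word → Word
refineD : ℕ → ℕ → Word → Word
-- Default for a word ending in U, which no path does; it keeps `refineU-StartsU` true for all
-- words.
refineU u []      = [ U ]
refineU u (U ∷ w) = refineU (suc u) w
refineU u (D ∷ w) = refineD u 0 w
refineD u d []      = zigzag u d
refineD u d (D ∷ w) = refineD u (suc d) w
refineD u d (U ∷ w) = zigzag u d ++ refineU 0 w

data StartsU : Word → Set where
  U∷_ : ∀ w → StartsU (U ∷ w)

valleys-StartsU : ∀ {w} x y → StartsU w → valleys D x y w ≡ (x , y) ∷ valleys U x y w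
valleys-StartsU x y (U∷ w) = refl

zigzag-StartsU : ∀ u d → StartsU (zigzag u d)
zigzag-StartsU zero    d       = U∷ _
zigzag-StartsU (suc u) zero    = U∷ _
zigzag-StartsU (suc u) (suc d) = U∷ _

refineU-StartsU : ∀ u w → StartsU (refineU u w)
refineD-StartsU : ∀ u d w → StartsU (refineD u d w)
refineU-StartsU u []      = U∷ []
refineU-StartsU u (U ∷ w) = refineU-StartsU (suc u) w
refineU-StartsU u (D ∷ w) = refineD-StartsU u 0 w
refineD-StartsU u d []      = zigzag-StartsU u d
refineD-StartsU u d (D ∷ w) = refineD-StartsU u (suc d) w
refineD-StartsU u d (U ∷ w) with zigzag u d | zigzag-StartsU u d
... | _ | U∷ v = U∷ (v ++ refineU 0 w)

descents-LastD : ∀ s d → LastD s (replicate (suc d) D)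
descents-LastD s zero    = D ∷ []
descents-LastD s (suc d) = D ∷ descents-LastD D d

zigzag-LastD : ∀ s u d → LastD s (zigzag u d)
zigzag-LastD s zero    d       = U ∷ descents-LastD U d
zigzag-LastD s (suc u) zero    = U ∷ zigzag-LastD U u zero
zigzag-LastD s (suc u) (suc d) = U ∷ D ∷ zigzag-LastD D u d

descents-counts : ∀ d → #U (replicate d D) ≡ 0 × #D (replicate d D) ≡ d
descents-counts zero    = refl , refl
descents-counts (suc d) = proj₁ (descents-counts d) , cong suc (proj₂ (descents-counts d))

zigzag-#U : ∀ u d → #U (zigzag u d) ≡ suc u
zigzag-#U zero    d       = cong suc (proj₁ (descents-counts d))
zigzag-#U (suc u) zero    = cong suc (zigzag-#U u zero)
zigzag-#U (suc u) (suc d) = cong suc (zigzag-#U u d)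

zigzag-#D : ∀ u d → #D (zigzag u d) ≡ suc d
zigzag-#D zero    d       = cong suc (proj₂ (descents-counts d))
zigzag-#D (suc u) zero    = zigzag-#D u zero
zigzag-#D (suc u) (suc d) = cong suc (zigzag-#D u d)

descents-valleys : ∀ s x y d → valleys s x y (replicate d D) ≡ []
descents-valleys s x y zero    = refl
descents-valleys s x y (suc d) = descents-valleys D x (suc y) d

zigzag-#valleys : ∀ u d x y → length (valleys U x y (zigzag u d)) ≡ u ⊓ d
zigzag-#valleys zero    d       x y = cong length (descents-valleys D (suc x) (suc y) d)
zigzag-#valleys (suc u) zero    x y = trans (zigzag-#valleys u zero (suc x) y) (⊓-zeroʳ u)
zigzag-#valleys (suc u) (suc d) x y = trans
  (cong length (valleys-StartsU (suc x) (suc y) (zigzag-StartsU u d)))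
  (cong suc (zigzag-#valleys u d (suc x) (suc y)))

descents-Path : ∀ {g a w} d → Path g a w → Path (d + g) a (replicate d D ++ w)
descents-Path zero    p = p
descents-Path (suc d) p = down (descents-Path d p)

-- The equation says that the zigzag leads from height `h` to height `g`. Its UD pairs return to `h`
-- and its last descent ends at `g`, so it never goes below 0.
zigzag-Path : ∀ {g a w} u d h → Path g a w → g + d ≡ h + u → Path h (suc u + a) (zigzag u d ++ w)
zigzag-Path {g} {a} {w} zero d h p e =
  up (subst (λ k → Path k a (replicate (suc d) D ++ w))
    (cong suc (trans (+-comm d g) (trans e (+-identityʳ h)))) (descents-Path (suc d) p))
zigzag-Path (suc u) zero    h p e = up (zigzag-Path u zero (suc h) p (trans e (+-suc h u)))
zigzag-Path {g} (suc u) (suc d) h p e = up (down (zigzag-Path u d h p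
  (suc-injective (trans (sym (+-suc g d)) (trans e (+-suc h u))))))

-- Here `h` is the height at which the current portion began, and the equation gives the height `g`
-- reached after its letters read so far.
refineU-Path : ∀ {g a w} u h → Path g a w → g ≡ suc (h + u) → Path h (suc u + a) (refineU u w)
refineD-Path : ∀ {g a w} u d h → Path g a w → g + d ≡ h + u → Path h (suc u + a) (refineD u d w)
refineU-Path u h (up {a = a} {w = w} p) e = subst (λ k → Path h (suc k) (refineU (suc u) w)) (sym (+-suc u a))
  (refineU-Path (suc u) h p (cong suc (trans e (sym (+-suc h u)))))
refineU-Path u h (down {h = g} p) e = refineD-Path u 0 h p (trans (+-identityʳ g) (suc-injective e))
refineD-Path u d h end e = subst (Path h (suc u + 0)) (++-identityʳ (zigzag u d)) (zigzag-Path u d h end e)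
refineD-Path u d h (down {h = g} p) e = refineD-Path u (suc d) h p (trans (+-suc g d) e)
refineD-Path u d h (up {h = g} p) e =
  zigzag-Path u d h (refineU-Path 0 g p (cong suc (sym (+-identityʳ g)))) e

valleys-zigzag-++ : ∀ u d x y w → StartsU w → valleys U x y (zigzag u d ++ w)
  ≡ valleys U x y (zigzag u d) ++ (x + suc u , y + suc d) ∷ valleys U (x + suc u) (y + suc d) w
valleys-zigzag-++ u d x y w sw = trans (valleys-++ x y w (zigzag-LastD U u d))
  (trans (cong₂ (λ p q → valleys U x y (zigzag u d) ++ valleys D (x + p) (y + q) w) (zigzag-#U u d) (zigzag-#D u d))
    (cong (valleys U x y (zigzag u d) ++_) (valleys-StartsU (x + suc u) (y + suc d) sw)))

-- A zigzag has the letter counts of the portion it replaces, ends in D and is followed by a U, so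
-- every old valley survives as a junction of zigzags.
refineU-⊆ : ∀ u w x y {x′} → x′ ≡ x + suc u → valleys U x′ y w ⊆ valleys U x y (refineU u w)
refineD-⊆ : ∀ u d w x y {x′ y′} → x′ ≡ x + suc u → y′ ≡ y + suc d →
  valleys D x′ y′ w ⊆ valleys U x y (refineD u d w)
refineU-⊆ u (U ∷ w) x y e z∈ = refineU-⊆ (suc u) w x y (trans (cong suc e) (sym (+-suc x (suc u)))) z∈
refineU-⊆ u (D ∷ w) x y e z∈ = refineD-⊆ u 0 w x y e (+-comm 1 y) z∈
refineD-⊆ u d (D ∷ w) x y ex ey z∈ =
  refineD-⊆ u (suc d) w x y ex (trans (cong suc ey) (sym (+-suc y (suc d)))) z∈
refineD-⊆ u d (U ∷ w) x y {x′} {y′} refl refl z∈ =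
  subst (_ ∈_) (sym (valleys-zigzag-++ u d x y (refineU 0 w) (refineU-StartsU 0 w)))
    (∈-++⁺ʳ (valleys U x y (zigzag u d)) (step z∈))
  where
  step : (x′ , y′) ∷ valleys U (suc x′) y′ w ⊆ (x′ , y′) ∷ valleys U x′ y′ (refineU 0 w)
  step (here e)    = here e
  step (there z∈′) = there (refineU-⊆ 0 w x′ y′ (+-comm 1 x′) z∈′)

-- A zigzag has one inner valley fewer than the minimum of its letter counts. The junction after it
-- makes up for this except at the last portion, whence the single `suc`.
portionMins≤refineU : ∀ u w x y → portionMins U (suc u) 0 w ≤ suc (length (valleys U x y (refineU u w)))
portionMins≤refineD : ∀ u d w x y →
  portionMins D (suc u) (suc d) w ≤ suc (length (valleys U x y (refineD u d w)))
portionMins≤refineU u []      x y = z≤n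
portionMins≤refineU u (U ∷ w) x y = portionMins≤refineU (suc u) w x y
portionMins≤refineU u (D ∷ w) x y = portionMins≤refineD u 0 w x y
portionMins≤refineD u d []      x y = s≤s (≤-reflexive (sym (zigzag-#valleys u d x y)))
portionMins≤refineD u d (D ∷ w) x y = portionMins≤refineD u (suc d) w x y
portionMins≤refineD u d (U ∷ w) x y = begin
  suc (u ⊓ d) + portionMins U 1 0 w
    ≤⟨ +-monoʳ-≤ (suc (u ⊓ d)) (portionMins≤refineU 0 w (x + suc u) (y + suc d)) ⟩
  suc (u ⊓ d) + suc (length rest)
    ≡⟨ cong (λ k → suc (k + suc (length rest))) (zigzag-#valleys u d x y) ⟨
  suc (length (valleys U x y (zigzag u d)) + suc (length rest))
    ≡⟨ cong suc (length-++ (valleys U x y (zigzag u d))) ⟨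
  suc (length (valleys U x y (zigzag u d) ++ (x + suc u , y + suc d) ∷ rest))
    ≡⟨ cong (λ l → suc (length l)) (valleys-zigzag-++ u d x y (refineU 0 w) (refineU-StartsU 0 w)) ⟨
  suc (length (valleys U x y (zigzag u d ++ refineU 0 w))) ∎
  where
  open ≤-Reasoning
  rest = valleys U (x + suc u) (y + suc d) (refineU 0 w)

-- The complex of valley sets

isPathWith⇒Path : ∀ w s h a k x y → T (isPathWith w s h a k) → Path h a w × length (valleys s x y w) ≡ k
isPathWith⇒Path []      s zero    zero    zero    x y t = end , refl
isPathWith⇒Path (U ∷ w) U h       (suc a) k       x y t with isPathWith⇒Path w U (suc h) a k (suc x) y t
... | p , e = up p , e
isPathWith⇒Path (U ∷ w) D h       (suc a) (suc k) x y t with isPathWith⇒Path w U (suc h) a k (suc x) y t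
... | p , e = up p , cong suc e
isPathWith⇒Path (D ∷ w) s (suc h) a       k       x y t with isPathWith⇒Path w D h a k x (suc y) t
... | p , e = down p , e

Path⇒isPathWith : ∀ {h a w} s x y → Path h a w → T (isPathWith w s h a (length (valleys s x y w)))
Path⇒isPathWith s x y end      = _
Path⇒isPathWith U x y (up p)   = Path⇒isPathWith U (suc x) y p
Path⇒isPathWith D x y (up p)   = Path⇒isPathWith U (suc x) y p
Path⇒isPathWith s x y (down p) = Path⇒isPathWith D x (suc y) p

-- Sum and difference add up to 2p. Hence abscissa and height together determine the numbers of U's
-- and D's.
⊖-cancelˡ : ∀ p q x y → p + q ≡ x + y → p ⊖ q ≡ x ⊖ y → p ≡ x
⊖-cancelˡ p q x y e₊ e₋ = *-cancelˡ-≡ p x 2 $ ℤₚ.+-injective $ begin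
  + (2 * p)                     ≡⟨ twice p q ⟩
  (p ⊖ q) ℤ.+ + (p + q)         ≡⟨ cong₂ (λ i j → i ℤ.+ + j) e₋ e₊ ⟩
  (x ⊖ y) ℤ.+ + (x + y)         ≡⟨ twice x y ⟨
  + (2 * x)                     ∎
  where
  open ≡-Reasoning
  twice : ∀ p q → + (2 * p) ≡ (p ⊖ q) ℤ.+ + (p + q)
  twice p q = sym (begin
    (p ⊖ q) ℤ.+ + (p + q)        ≡⟨ ℤₚ.distribˡ-⊖-+-pos (p + q) p q ⟩
    (p + (p + q)) ⊖ q            ≡⟨ cong₂ _⊖_ (trans (sym (+-assoc p p q)) (+-comm (p + p) q)) (sym (+-identityʳ q)) ⟩
    (q + (p + p)) ⊖ (q + 0)      ≡⟨ ℤₚ.+-cancelˡ-⊖ q (p + p) 0 ⟩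
    + (p + p)                    ≡⟨ cong +_ (double p) ⟨
    + (2 * p)                    ∎)

position-injective : ∀ {z z′} → position z ≡ position z′ → z ≡ z′
position-injective {p , q} {x , y} e with ⊖-cancelˡ p q x y (cong proj₁ e) (cong proj₂ e)
... | refl = cong (p ,_) (+-cancelˡ-≡ p q y (cong proj₁ e))

V-⊆⁻ : ∀ v w → V v ⊆ V w → valleys U 0 0 v ⊆ valleys U 0 0 w
V-⊆⁻ v w ⊆w {z} z∈ rewrite V≡valleys v | V≡valleys w
  with ∈-map⁻ position (⊆w (∈-map⁺ position z∈))
... | _ , z∈′ , e = subst (_∈ valleys U 0 0 w) (sym (position-injective e)) z∈′

V-⊆⁺ : ∀ v w → valleys U 0 0 v ⊆ valleys U 0 0 w → V v ⊆ V w
V-⊆⁺ v w ⊆w rewrite V≡valleys v | V≡valleys w = map⁺ position ⊆w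

length-V : ∀ w → length (V w) ≡ length (valleys U 0 0 w)
length-V w = trans (cong length (V≡valleys w)) (length-map position (valleys U 0 0 w))

V-injective : ∀ {n v w} → Path 0 n v → Path 0 n w → V v ≐ V w → v ≡ w
V-injective {v = v} {w} p q (⊆w , ⊆v) = valleys-injective U 0 0 p q (V-⊆⁻ v w ⊆w) (V-⊆⁻ w v ⊆v)

AllPairs-V : ∀ {n ws} → Unique ws → All (Path 0 n) ws → AllPairs (λ v w → ¬ V v ≐ V w) ws
AllPairs-V []                  []       = []
AllPairs-V (v≢ws ∷ distinct) (p ∷ ps) =
  All.zipWith (λ (v≢w , q) e → v≢w (V-injective p q e)) (v≢ws , ps) ∷ AllPairs-V distinct ps

-- Different paths have different valley sets, so deduplication removes nothing and faces can be
-- counted as paths.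
ΔDyck≡map-V : ∀ n → ΔDyck n ≡ map V (Dyck n)
ΔDyck≡map-V n = deduplicate-id _≐?_ (AllPairsₚ.map⁺
  (AllPairs-V (Uniqueₚ.filter⁺ isDyck? (words-unique (2 * n))) (All.tabulate (∈-Dyck⁻ n))))

-- Each valley has its own U immediately after it, and the initial U follows no valley.
#V<n : ∀ {n w} → Path 0 (suc n) w → length (V w) < suc n
#V<n {n} {U ∷ w} p = subst₂ _<_ (sym (length-V (U ∷ w))) (Path⇒#U p) (s≤s (#valleys≤#U U 1 0 w))

-- A nonempty path begins with U, which `refineU 0` takes as already read.
refine : Word → Word
refine []      = []
refine (s ∷ w) = refineU 0 w

refine-Path : ∀ {n w} → Path 0 (suc n) w → Path 0 (suc n) (refine w)
refine-Path (up p) = refineU-Path 0 0 p refl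

V-⊆-refine : ∀ {n w} → Path 0 (suc n) w → V w ⊆ V (refine w)
V-⊆-refine {w = U ∷ w} (up p) = V-⊆⁺ (U ∷ w) (refineU 0 w) (refineU-⊆ 0 w 0 0 refl)

portionMins≤#V-refine : ∀ {n w} → Path 0 (suc n) w → portionMins U 0 0 w ≤ suc (length (V (refine w)))
portionMins≤#V-refine {w = U ∷ w} (up p) = subst (λ k → portionMins U 1 0 w ≤ suc k)
  (sym (length-V (refineU 0 w))) (portionMins≤refineU 0 w 0 0)

#V<portionMins : ∀ {n v w} → Path 0 (suc n) w → Path 0 (suc n) v → V w ⊆ V v →
  length (V v) < portionMins U 0 0 w
#V<portionMins {v = U ∷ v} {U ∷ w} p@(up p′) q@(up q′) ⊆v = subst (_< portionMins U 1 0 w) (sym (length-V (U ∷ v)))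
  (#valleys<portionMins w U 1 0 0 0 v refl refl (V-⊆⁻ (U ∷ w) (U ∷ v) ⊆v)
    (trans (Path⇒#U q) (sym (Path⇒#U p))) (trans (Path⇒#D q) (sym (Path⇒#D p))) (Path⇒LastD⁺ U q′))

faces : ℕ → Complex
faces n = map V (Dyck n)

-- The degree of a face

module _ {n : ℕ} {w : Word} (p : Path 0 (suc n) w) where

  private
    N = suc n
    cofaces = filter (V w ⊆?_) (faces N)

    -- The hypothesis `0 < b` covers the default value 0 of `max`.
    deg-< : ∀ {b} → 0 < b → (∀ v → Path 0 N v → V w ⊆ V v → length (V v) < b) → deg (faces N) (V w) < b
    deg-< 0<b bound = max<v⁺ 0<b (Allₚ.map⁺ (All.tabulate below))
      where
      below : ∀ {σ} → σ ∈ cofaces → length σ < _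
      below σ∈ with ∈-filter⁻ (V w ⊆?_) {xs = faces N} σ∈
      ... | σ∈Δ , w⊆σ with ∈-map⁻ V σ∈Δ
      ...   | v , v∈ , refl = bound v (∈-Dyck⁻ N v∈) w⊆σ

    ≤-deg : ∀ v → Path 0 N v → V w ⊆ V v → length (V v) ≤ deg (faces N) (V w)
    ≤-deg v q w⊆v = All.lookup (xs≤max 0 (map length cofaces))
      (∈-map⁺ length (∈-filter⁺ (V w ⊆?_) (∈-map⁺ V (∈-Dyck⁺ q)) w⊆v))

  deg<n : deg (faces N) (V w) < N
  deg<n = deg-< (s≤s z≤n) (λ v q _ → #V<n q)

  #V≤deg : length (V w) ≤ deg (faces N) (V w)
  #V≤deg = ≤-deg w p (λ z∈ → z∈)

  -- Every face containing `V w` obeys the bound by portions, and the refined path attains it. The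
  -- `suc` matches the -1 in `μ`.
  suc-deg : suc (deg (faces N) (V w)) ≡ portionMins U 0 0 w
  suc-deg = ≤-antisym
    (deg-< (≤-trans (s≤s z≤n) (#V<portionMins p p (λ z∈ → z∈))) (λ v q → #V<portionMins p q))
    (≤-trans (portionMins≤#V-refine p)
      (s≤s (≤-deg (refine w) (refine-Path p) (V-⊆-refine p))))

  μ≡deg : μ w ≡ + deg (faces N) (V w)
  μ≡deg = trans (μ≡portionMins w) (cong (_⊖ 1) (sym suc-deg))

-- Column sums, row sums and the f-vector

⊖1-injective : ∀ m n → m ⊖ 1 ≡ n ⊖ 1 → m ≡ n
⊖1-injective zero    zero    e  = refl
⊖1-injective (suc m) (suc n) e  = cong suc (ℤₚ.+-injective e)
⊖1-injective zero    (suc n) ()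
⊖1-injective (suc m) zero    ()

All-faces : ∀ n {P : Face → Set} → (∀ {w} → Path 0 n w → P (V w)) → All P (faces n)
All-faces n f = Allₚ.map⁺ (All.tabulate (λ w∈ → f (∈-Dyck⁻ n w∈)))

fNumber-count : ∀ n j → fNumber (faces n) (j ⊖ 1) ≡ count U 0 n j (2 * n)
fNumber-count n j = begin
  length (filter (λ σ → dim σ ≟ (j ⊖ 1)) (map V (Dyck n)))
    ≡⟨ length-filter-map (λ σ → dim σ ≟ (j ⊖ 1)) V (Dyck n) ⟩
  length (filter (λ w → dim (V w) ≟ (j ⊖ 1)) (Dyck n))
    ≡⟨ length-filter-filter isDyck? (λ w → dim (V w) ≟ (j ⊖ 1)) (words (2 * n)) ⟩
  length (filter (λ w → isDyck? w ×-dec (dim (V w) ≟ (j ⊖ 1))) (words (2 * n)))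
    ≡⟨ length-filter-cong _ _ (All.tabulate (λ {w} w∈ → to w w∈ , from w)) ⟩
  count U 0 n j (2 * n) ∎
  where
  open ≡-Reasoning
  to : ∀ w → w ∈ words (2 * n) → IsDyck w × dim (V w) ≡ j ⊖ 1 → T (isPathWith w U 0 n j)
  to w w∈ (dyck , e) = subst (λ k → T (isPathWith w U 0 n k))
    (trans (sym (length-V w)) (⊖1-injective _ j e))
    (Path⇒isPathWith U 0 0 (IsDyck⇒Path n (∈-words⁻ (2 * n) w∈) dyck))
  from : ∀ w → T (isPathWith w U 0 n j) → IsDyck w × dim (V w) ≡ j ⊖ 1
  from w t with isPathWith⇒Path w U 0 n j 0 0 t
  ... | p , e = Path⇒IsDyck p , cong (_⊖ 1) (trans (length-V w) e)

toℚ≡/ : ∀ k m n → k * suc n ≡ m → toℚ k ≡ (+ m) / suc n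
-- `mkℚᵘ` stores the denominator minus one, so 0 and `n` stand for 1 and `suc n`;
-- cross-multiplication then suffices.
toℚ≡/ k m n e = fromℚᵘ-cong {mkℚᵘ (+ k) 0} {mkℚᵘ (+ m) n} (*≡* (begin
  + k ℤ.* + suc n    ≡⟨ ℤₚ.pos-* k (suc n) ⟨
  + (k * suc n)      ≡⟨ cong +_ (trans e (sym (*-identityʳ m))) ⟩
  + (m * 1)          ≡⟨ ℤₚ.pos-* m 1 ⟩
  + m ℤ.* + 1        ∎))
  where open ≡-Reasoning

toℚ≡narayana : ∀ k n j → k * suc n ≡ (suc n C suc j) * (suc n C j) → toℚ k ≡ narayana (suc n) (suc j)
toℚ≡narayana k n j = toℚ≡/ k ((suc n C suc j) * (suc n C j)) n

fNumber≡narayana : ∀ n j → toℚ (fNumber (faces (suc n)) (j ⊖ 1)) ≡ narayana (suc n) (suc j)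
fNumber≡narayana n j = toℚ≡narayana (fNumber (faces (suc n)) (j ⊖ 1)) n j
  (trans (cong (_* suc n) (fNumber-count (suc n) j))
    (narayana-count n j (2 * suc n) (double (suc n))))

-- All degrees are below `suc n`, so any cutoff `m` from there on captures the full sum over i.
column-sum : ∀ n j m → suc n ≤ m →
  fNumber (faces (suc n)) (j ⊖ 1) ≡ ∑[ i < m ] fTriangle (faces (suc n)) i j
column-sum n j m n≤m = sym (∑-fibres (deg Δ) (λ σ → dim σ ≟ (j ⊖ 1))
  (λ i σ → (length σ ℕₚ.≟ j) ×-dec (deg Δ σ ℕₚ.≟ i))
  (λ (e , d) → d , cong (_⊖ 1) e) (λ (d , e) → ⊖1-injective _ j e , d)
  Δ m (All-faces (suc n) (λ p _ → ≤-trans (deg<n p) n≤m)))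
  where
  Δ = faces (suc n)

-- A face has at most as many elements as its degree, so j up to i reaches every face of degree i;
-- these correspond to the paths with `μ` equal to i.
row-sum : ∀ n i →
  ∑[ j < suc i ] fTriangle (faces (suc n)) i j ≡ length (filter (λ w → μ w ≟ + i) (Dyck (suc n)))
row-sum n i = begin
  ∑[ j < suc i ] fTriangle Δ i j
    ≡⟨ ∑-fibres length (λ σ → deg Δ σ ℕₚ.≟ i) (λ j σ → (length σ ℕₚ.≟ j) ×-dec (deg Δ σ ℕₚ.≟ i))
         (λ e → e) (λ e → e) Δ (suc i)
         (All-faces (suc n) (λ p d → s≤s (≤-trans (#V≤deg p) (≤-reflexive d)))) ⟩
  length (filter (λ σ → deg Δ σ ℕₚ.≟ i) (map V (Dyck (suc n))))
    ≡⟨ length-filter-map (λ σ → deg Δ σ ℕₚ.≟ i) V (Dyck (suc n)) ⟩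
  length (filter (λ w → deg Δ (V w) ℕₚ.≟ i) (Dyck (suc n)))
    ≡⟨ length-filter-cong _ _ (All.tabulate λ w∈ →
         (λ d → trans (μ≡deg (∈-Dyck⁻ (suc n) w∈)) (cong +_ d)) ,
         (λ e → ℤₚ.+-injective (trans (sym (μ≡deg (∈-Dyck⁻ (suc n) w∈))) e))) ⟩
  length (filter (λ w → μ w ≟ + i) (Dyck (suc n))) ∎
  where
  open ≡-Reasoning
  Δ = faces (suc n)

-- The maximum is attained by `zigzag n n`, the word (UD)^(n+1), which has n valleys.
max-dimension : ∀ n → suc (max 0 (map length (faces (suc n)))) ≡ suc n
max-dimension n = ≤-antisym
  (max<v⁺ (s≤s z≤n) (Allₚ.map⁺ (All-faces (suc n) #V<n)))
  (s≤s (≤-trans (≤-reflexive (sym #V-top))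
    (All.lookup (xs≤max 0 (map length (faces (suc n)))) (∈-map⁺ length (∈-map⁺ V (∈-Dyck⁺ top-Path))))))
  where
  top-Path : Path 0 (suc n) (zigzag n n)
  top-Path = subst₂ (Path 0) (+-identityʳ (suc n)) (++-identityʳ (zigzag n n)) (zigzag-Path n n 0 end refl)
  #V-top : length (V (zigzag n n)) ≡ n
  #V-top = trans (length-V (zigzag n n)) (trans (zigzag-#valleys n n 0 0) (⊓-idem n))

fVector≡narayana : ∀ n → map toℚ (fVector (faces (suc n))) ≡ map (λ j → narayana (suc n) (suc j)) (upTo (suc n))
fVector≡narayana n = begin
  map toℚ (map f (upTo (suc (max 0 (map length (faces (suc n)))))))
    ≡⟨ cong (λ m → map toℚ (map f (upTo m))) (max-dimension n) ⟩
  map toℚ (map f (upTo (suc n)))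
    ≡⟨ map-∘ (upTo (suc n)) ⟨
  map (λ j → toℚ (f j)) (upTo (suc n))
    ≡⟨ map-cong (fNumber≡narayana n) (upTo (suc n)) ⟩
  map (λ j → narayana (suc n) (suc j)) (upTo (suc n)) ∎
  where
  open ≡-Reasoning
  f = λ j → fNumber (faces (suc n)) (j ⊖ 1)

corollary3p8 : (n : ℕ) → .{{_ : NonZero n}} →
    (∀ j → j < n →
    (∀ m → n ≤ m → fNumber (ΔDyck n) (j ⊖ 1) ≡ ∑[ i < m ] fTriangle (ΔDyck n) i j)
    × toℚ (fNumber (ΔDyck n) (j ⊖ 1)) ≡ narayana n (suc j))
    × map toℚ (fVector (ΔDyck n)) ≡ map (λ j → narayana n (suc j)) (upTo n)
    × (∀ i → i < n →
    ∑[ j < suc i ] fTriangle (ΔDyck n) i j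
    ≡ length (filter (λ w → μ w ≟ + i) (Dyck n)))
corollary3p8 zero {{n≢0}} = ⊥-elim (≢-nonZero⁻¹ 0 {{n≢0}} refl)
corollary3p8 (suc n) =
  (λ j _ →
    (λ m n≤m → subst (λ Δ → fNumber Δ (j ⊖ 1) ≡ ∑[ i < m ] fTriangle Δ i j) faces≡ΔDyck (column-sum n j m n≤m)) ,
    subst (λ Δ → toℚ (fNumber Δ (j ⊖ 1)) ≡ narayana (suc n) (suc j)) faces≡ΔDyck (fNumber≡narayana n j)) ,
  subst (λ Δ → map toℚ (fVector Δ) ≡ map (λ j → narayana (suc n) (suc j)) (upTo (suc n)))
    faces≡ΔDyck (fVector≡narayana n) ,
  (λ i _ → subst (λ Δ → ∑[ j < suc i ] fTriangle Δ i j ≡ length (filter (λ w → μ w ≟ + i) (Dyck (suc n))))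
    faces≡ΔDyck (row-sum n i))
  where
  faces≡ΔDyck : faces (suc n) ≡ ΔDyck (suc n)
  faces≡ΔDyck = sym (ΔDyck≡map-V (suc n))
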